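{- Let $n\geq 1$ and let $\mathcal{N}:L_n([0,1])\to L_n([0,1])$ be an $n$-dimensional strong fuzzy negation. Then there exists an element $/e/\in\mathcal{D}_n$ such that $/e/$ is an $n$-dimensional equilibrium point of $\mathcal{N}$, i.e. $\mathcal{N}(/e/)=/e/$.
   Context: $L_n([0,1])=\{(x_1,\ldots,x_n)\in[0,1]^n : x_1\leq\cdots\leq x_n\}$ with the componentwise order. For $x\in[0,1]$, $/x/=(x,\ldots,x)$; $\mathcal{D}_n=\{/x/ : x\in[0,1]\}$. An $n$-dimensional fuzzy negation is a function $\mathcal{N}:L_n([0,1])\to L_n([0,1])$ with $\mathcal{N}(/0/)=/1/$, $\mathcal{N}(/1/)=/0/$ and $\mathcal{N}(\mathbf{x})\geq\mathcal{N}(\mathbf{y})$ whenever $\mathbf{x}\leq\mathbf{y}$. It is strong if $\mathcal{N}(\mathcal{N}(\mathbf{x}))=\mathbf{x}$ for all $\mathbf{x}$. -}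

module Defs where

open import Data.Fin as Fin using (Fin)
open import Data.Nat using (ℕ)
open import Data.Product using (_×_; _,_; ∃-syntax; proj₁; proj₂)
open import Data.Rational as ℚ using (ℚ; 0ℚ; 1ℚ)
import Data.Rational.Properties as ℚ
open import Data.Sum using (_⊎_; inj₁; inj₂)
open import Data.Vec.Functional using (Vector)
open import Data.Vec.Functional.Relation.Binary.Pointwise using (Pointwise)
open import Function using (_⇔_; mk⇔; _on_; Equivalence)
open import Level using (0ℓ)
open import Relation.Binary.Bundles using (Poset)
open import Relation.Binary.Core using (Rel)
open import Relation.Nullary using (¬_; yes; no; contradiction)
open import Relation.Unary using (Pred; _⊆_)

-- Two-sided Dedekind cuts of rationals.  Both halves are predicates rather
-- than sets, so equality of reals is the relation _≈ᴿ_ below, not _≡_.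
record ℝ : Set₁ where
  field
    Lower            : Pred ℚ 0ℓ
    Upper            : Pred ℚ 0ℓ
    lower-inhabited  : ∃[ q ] Lower q
    upper-inhabited  : ∃[ q ] Upper q
    lower-rounded    : ∀ q → Lower q ⇔ (∃[ r ] (q ℚ.< r × Lower r))
    upper-rounded    : ∀ q → Upper q ⇔ (∃[ p ] (p ℚ.< q × Upper p))
    disjoint         : ∀ q → ¬ (Lower q × Upper q)
    located          : ∀ {p q} → p ℚ.< q → Lower p ⊎ Upper q

open ℝ public

infix 4 _≤ᴿ_ _≈ᴿ_

_≤ᴿ_ : Rel ℝ 0ℓ
x ≤ᴿ y = Lower x ⊆ Lower y

-- The lower half of a cut determines the upper half (see ≈ᴿ⇒upper), so
-- this is equality of cuts.
_≈ᴿ_ : Rel ℝ 0ℓ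
x ≈ᴿ y = x ≤ᴿ y × y ≤ᴿ x

≤ᴿ⇒upper : ∀ {x y} → x ≤ᴿ y → Upper y ⊆ Upper x
≤ᴿ⇒upper {x} {y} x≤y {q} q∈U with Equivalence.to (upper-rounded y q) q∈U
... | p , p<q , p∈U with located x p<q
...   | inj₁ p∈L = contradiction (x≤y p∈L , p∈U) (disjoint y p)
...   | inj₂ q∈Ux = q∈Ux

≈ᴿ⇒upper : ∀ {x y} → x ≈ᴿ y → Upper x ⊆ Upper y
≈ᴿ⇒upper {x} {y} (_ , y≤x) = ≤ᴿ⇒upper {y} {x} y≤x

fromℚ : ℚ → ℝ
fromℚ a = record
  { Lower           = ℚ._< a
  ; Upper           = a ℚ.<_
  ; lower-inhabited = a ℚ.- 1ℚ , below
  ; upper-inhabited = a ℚ.+ 1ℚ , above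
  ; lower-rounded   = λ q → mk⇔ (λ q<a → let (m , q<m , m<a) = ℚ.<-dense q<a in m , q<m , m<a)
                                (λ (r , q<r , r<a) → ℚ.<-trans q<r r<a)
  ; upper-rounded   = λ q → mk⇔ (λ a<q → let (m , a<m , m<q) = ℚ.<-dense a<q in m , m<q , a<m)
                                (λ (p , p<q , a<p) → ℚ.<-trans a<p p<q)
  ; disjoint        = λ q (q<a , a<q) → ℚ.<-asym q<a a<q
  ; located         = loc
  }
  where
  open ℚ.≤-Reasoning

  below : a ℚ.- 1ℚ ℚ.< a
  below = begin-strict
    a ℚ.- 1ℚ  <⟨ ℚ.+-monoʳ-< a (ℚ.negative⁻¹ (ℚ.- 1ℚ)) ⟩
    a ℚ.+ 0ℚ  ≡⟨ ℚ.+-identityʳ a ⟩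
    a         ∎

  above : a ℚ.< a ℚ.+ 1ℚ
  above = begin-strict
    a         ≡⟨ ℚ.+-identityʳ a ⟨
    a ℚ.+ 0ℚ  <⟨ ℚ.+-monoʳ-< a (ℚ.positive⁻¹ 1ℚ) ⟩
    a ℚ.+ 1ℚ  ∎

  loc : ∀ {p q} → p ℚ.< q → p ℚ.< a ⊎ a ℚ.< q
  loc {p} p<q with p ℚ.<? a
  ... | yes p<a = inj₁ p<a
  ... | no  p≮a = inj₂ (ℚ.≤-<-trans (ℚ.≮⇒≥ p≮a) p<q)

0ᴿ 1ᴿ : ℝ
0ᴿ = fromℚ 0ℚ
1ᴿ = fromℚ 1ℚ

record 𝕀 : Set₁ where
  constructor mk𝕀
  field
    value   : ℝ
    0≤value : 0ᴿ ≤ᴿ value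
    value≤1 : value ≤ᴿ 1ᴿ

open 𝕀 public

infix 4 _≤ᴵ_ _≈ᴵ_

_≤ᴵ_ _≈ᴵ_ : Rel 𝕀 0ℓ
_≤ᴵ_ = _≤ᴿ_ on value
_≈ᴵ_ = _≈ᴿ_ on value

0ᴵ 1ᴵ : 𝕀
0ᴵ = mk𝕀 0ᴿ (λ q<0 → q<0) (λ q<0 → ℚ.<-trans q<0 (ℚ.positive⁻¹ 1ℚ))
1ᴵ = mk𝕀 1ᴿ (λ q<0 → ℚ.<-trans q<0 (ℚ.positive⁻¹ 1ℚ)) (λ q<1 → q<1)

record L (n : ℕ) : Set₁ where
  constructor mkL
  field
    comp      : Vector 𝕀 n
    ascending : ∀ (i j : Fin n) → i Fin.≤ j → comp i ≤ᴵ comp j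

open L public

infix 4 _≤ᴸ_ _≈ᴸ_

_≤ᴸ_ _≈ᴸ_ : ∀ {n} → Rel (L n) 0ℓ
_≤ᴸ_ = Pointwise _≤ᴵ_ on comp
_≈ᴸ_ = Pointwise _≈ᴵ_ on comp

≤ᴸ-poset : ℕ → Poset _ _ _
≤ᴸ-poset n = record
  { Carrier = L n
  ; _≈_ = _≈ᴸ_
  ; _≤_ = _≤ᴸ_
  ; isPartialOrder = record
    { isPreorder = record
      { isEquivalence = record
        { refl  = λ i → (λ q → q) , (λ q → q)
        ; sym   = λ x≈y i → proj₂ (x≈y i) , proj₁ (x≈y i)
        ; trans = λ x≈y y≈z i → (λ q → proj₁ (y≈z i) (proj₁ (x≈y i) q))
                              , (λ q → proj₂ (x≈y i) (proj₂ (y≈z i) q))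
        }
      ; reflexive = λ x≈y i → proj₁ (x≈y i)
      ; trans     = λ x≤y y≤z i q → y≤z i (x≤y i q)
      }
    ; antisym = λ x≤y y≤x i → x≤y i , y≤x i
    }
  }

/_/ : ∀ {n} → 𝕀 → L n
/ x / = mkL (λ _ → x) (λ _ _ _ q → q)

𝒟 : ∀ n → Pred (L n) _
𝒟 n 𝐱 = ∃[ x ] 𝐱 ≈ᴸ / x /

record IsFuzzyNegation {n} (𝒩 : L n → L n) : Set₁ where
  field
    𝒩/0/≈/1/ : 𝒩 / 0ᴵ / ≈ᴸ / 1ᴵ /
    𝒩/1/≈/0/ : 𝒩 / 1ᴵ / ≈ᴸ / 0ᴵ /
    antitone : ∀ 𝐱 𝐲 → 𝐱 ≤ᴸ 𝐲 → 𝒩 𝐲 ≤ᴸ 𝒩 𝐱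

  -- Antitonicity already makes 𝒩 a well-defined map up to _≈ᴸ_, so
  -- congruence is not a separate field.
  cong : ∀ 𝐱 𝐲 → 𝐱 ≈ᴸ 𝐲 → 𝒩 𝐱 ≈ᴸ 𝒩 𝐲
  cong 𝐱 𝐲 𝐱≈𝐲 i = antitone 𝐲 𝐱 (λ j → proj₂ (𝐱≈𝐲 j)) i
                  , antitone 𝐱 𝐲 (λ j → proj₁ (𝐱≈𝐲 j)) i

record IsStrongFuzzyNegation {n} (𝒩 : L n → L n) : Set₁ where
  field
    isFuzzyNegation : IsFuzzyNegation 𝒩
    involutive      : ∀ 𝐱 → 𝒩 (𝒩 𝐱) ≈ᴸ 𝐱

  open IsFuzzyNegation isFuzzyNegation public

IsEquilibriumPoint : ∀ {n} → (L n → L n) → Pred (L n) 0ℓ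
IsEquilibriumPoint 𝒩 𝐞 = 𝒩 𝐞 ≈ᴸ 𝐞

{-# OPTIONS --safe #-}

-- Diagonal points are both join-prime and meet-prime in L n, so 𝒩 / x / is too,
-- and a gap between consecutive components of a doubly prime point forces 0 below
-- the gap and 1 above it.  But / x / is the supremum of the smaller diagonal
-- points, while the points 0…01…1 of the image are isolated; hence 𝒩 / x / has no
-- gap, 𝒩 preserves the diagonal, and it remains to fix a point of a strong
-- negation on [0,1].  That point is the cut { q : q < 𝒩 q }, which is located
-- because, for s < t, either s < 𝒩 s or 𝒩 t ≤ 𝒩 s < t.
module Submission where

open import Defs
open import Data.Empty using (⊥)
open import Data.Fin as Fin using (Fin; fromℕ; inject₁; toℕ)
import Data.Fin.Properties as Fin
open import Data.Nat as ℕ using (ℕ; suc; _≥_; s≤s; z≤n)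
import Data.Nat.Properties as ℕ
open import Data.Product using (_×_; _,_; proj₁; proj₂; ∃-syntax)
open import Data.Rational as ℚ using (ℚ; 0ℚ; 1ℚ; _⊓_; _⊔_)
import Data.Rational.Properties as ℚ
open import Data.Sum using (inj₁; inj₂)
open import Function using (mk⇔; Equivalence)
open import Relation.Binary.Definitions using (tri<; tri≈; tri>)
open import Relation.Binary.PropositionalEquality using (_≡_; refl; sym; subst)
open import Relation.Nullary using (¬_; yes; no; contradiction)
open import Relation.Unary using (_∈_)

-- Strict order on cuts.

infix 4 _<ᴿ_ _<ᴵ_

_<ᴿ_ : ℝ → ℝ → Set
x <ᴿ y = ∃[ q ] (Upper x q × Lower y q)

_<ᴵ_ : 𝕀 → 𝕀 → Set
x <ᴵ y = value x <ᴿ value y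

lower-< : ∀ x {p q} → p ℚ.< q → Lower x q → Lower x p
lower-< x p<q l = Equivalence.from (lower-rounded x _) (_ , p<q , l)

lower-≤ : ∀ x {p q} → p ℚ.≤ q → Lower x q → Lower x p
lower-≤ x {p} {q} p≤q l with ℚ.<-cmp p q
... | tri< p<q _ _ = lower-< x p<q l
... | tri≈ _ refl _ = l
... | tri> _ _ q<p = contradiction (ℚ.<-≤-trans q<p p≤q) (ℚ.<-irrefl refl)

upper-< : ∀ x {p q} → p ℚ.< q → Upper x p → Upper x q
upper-< x p<q u = Equivalence.from (upper-rounded x _) (_ , p<q , u)

lower<upper : ∀ x {p q} → Lower x p → Upper x q → p ℚ.< q
lower<upper x {p} {q} l u = ℚ.≰⇒> λ q≤p → disjoint x q (lower-≤ x q≤p l , u)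

-- Roundedness of `y` leaves room to locate `x`, and the unwanted alternative would witness
-- `x <ᴿ y`. This lets `≤ᴿ` be proved by contradiction without excluded middle.
≮⇒≥ᴿ : ∀ x y → ¬ (x <ᴿ y) → y ≤ᴿ x
≮⇒≥ᴿ x y x≮y {q} l with Equivalence.to (lower-rounded y q) l
... | r , q<r , l′ with located x q<r
...   | inj₁ l″ = l″
...   | inj₂ u  = contradiction (r , u , l′) x≮y

<⇒≱ᴿ : ∀ x y → x <ᴿ y → ¬ (y ≤ᴿ x)
<⇒≱ᴿ x y (q , u , l) y≤x = disjoint x q (y≤x l , u)

<⇒≤ᴿ : ∀ x y → x <ᴿ y → x ≤ᴿ y
<⇒≤ᴿ x y (q , u , l) l′ = lower-< y (lower<upper x l′ u) l

fromℚᴵ : ∀ q → 0ℚ ℚ.≤ q → q ℚ.≤ 1ℚ → 𝕀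
fromℚᴵ q 0≤q q≤1 = mk𝕀 (fromℚ q) (λ p<0 → ℚ.<-≤-trans p<0 0≤q) (λ p<q → ℚ.<-≤-trans p<q q≤1)

between : ∀ x y → x <ᴵ y → 𝕀
between x y (q , u , l) =
  fromℚᴵ q (ℚ.<⇒≤ (≤ᴿ⇒upper {0ᴿ} {value x} (0≤value x) u)) (ℚ.<⇒≤ (value≤1 y l))

<-between : ∀ x y x<y → x <ᴵ between x y x<y
<-between x y (q , u , l) with Equivalence.to (upper-rounded (value x) q) u
... | p , p<q , u′ = p , u′ , p<q

between-< : ∀ x y x<y → between x y x<y <ᴵ y
between-< x y (q , u , l) with Equivalence.to (lower-rounded (value y) q) l
... | r , q<r , l′ = r , q<r , l′

-- Primality in the unit interval.

𝕀-meetPrime : ∀ x a b → (∀ c → c ≤ᴵ a → c ≤ᴵ b → c ≤ᴵ x) → ¬ (a ≤ᴵ x) → ¬ (b ≤ᴵ x) → ⊥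
𝕀-meetPrime x a b glb a≰x b≰x =
  a≰x (≮⇒≥ᴿ (value x) (value a) λ x<a →
  b≰x (≮⇒≥ᴿ (value x) (value b) λ x<b → meet x<a x<b))
  where
  meet : x <ᴵ a → x <ᴵ b → ⊥
  -- The smaller of the two rational witnesses is a common lower bound of `a` and `b` strictly above
  -- `x`.
  meet x<a@(p , _ , p<a) x<b@(q , _ , q<b) with ℚ.≤-total p q
  ... | inj₁ p≤q = <⇒≱ᴿ (value x) (value (between x a x<a)) (<-between x a x<a)
    (glb (between x a x<a) (<⇒≤ᴿ (value (between x a x<a)) (value a) (between-< x a x<a))
      (λ l → lower-< (value b) l (lower-≤ (value b) p≤q q<b)))
  ... | inj₂ q≤p = <⇒≱ᴿ (value x) (value (between x b x<b)) (<-between x b x<b)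
    (glb (between x b x<b) (λ l → lower-< (value a) l (lower-≤ (value a) q≤p p<a))
      (<⇒≤ᴿ (value (between x b x<b)) (value b) (between-< x b x<b)))

𝕀-joinPrime : ∀ x a b → (∀ c → a ≤ᴵ c → b ≤ᴵ c → x ≤ᴵ c) → ¬ (x ≤ᴵ a) → ¬ (x ≤ᴵ b) → ⊥
𝕀-joinPrime x a b lub x≰a x≰b =
  x≰a (≮⇒≥ᴿ (value a) (value x) λ a<x →
  x≰b (≮⇒≥ᴿ (value b) (value x) λ b<x → join a<x b<x))
  where
  join : a <ᴵ x → b <ᴵ x → ⊥
  -- Dually, the larger witness is a common upper bound strictly below `x`.
  join a<x@(p , a<p , _) b<x@(q , b<q , _) with ℚ.≤-total p q
  ... | inj₁ p≤q = <⇒≱ᴿ (value (between b x b<x)) (value x) (between-< b x b<x)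
    (lub (between b x b<x) (λ l → ℚ.<-≤-trans (lower<upper (value a) l a<p) p≤q)
      (<⇒≤ᴿ (value b) (value (between b x b<x)) (<-between b x b<x)))
  ... | inj₂ q≤p = <⇒≱ᴿ (value (between a x a<x)) (value x) (between-< a x a<x)
    (lub (between a x a<x) (<⇒≤ᴿ (value a) (value (between a x a<x)) (<-between a x a<x))
      (λ l → ℚ.<-≤-trans (lower<upper (value b) l b<q) q≤p))

-- Splicing tuples at an index.

splice : ∀ {n} (𝐱 𝐲 : L n) → 𝐱 ≤ᴸ 𝐲 → ℕ → L n
splice {n} 𝐱 𝐲 𝐱≤𝐲 t = mkL at mono
  where
  at : Fin n → 𝕀
  at i with toℕ i ℕ.<? t
  ... | yes _ = comp 𝐱 i
  ... | no  _ = comp 𝐲 i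

  mono : ∀ i j → i Fin.≤ j → at i ≤ᴵ at j
  mono i j i≤j with toℕ i ℕ.<? t | toℕ j ℕ.<? t
  ... | yes _  | yes _  = ascending 𝐱 i j i≤j
  ... | yes _  | no _   = λ l → 𝐱≤𝐲 j (ascending 𝐱 i j i≤j l)
  ... | no i≮t | yes j<t = contradiction (ℕ.≤-<-trans i≤j j<t) i≮t
  ... | no _   | no _   = ascending 𝐲 i j i≤j

module _ {n} (𝐱 𝐲 : L n) (𝐱≤𝐲 : 𝐱 ≤ᴸ 𝐲) (t : ℕ) where

  splice-≤ : ∀ 𝐳 → (∀ i → toℕ i ℕ.< t → comp 𝐱 i ≤ᴵ comp 𝐳 i) →
    (∀ i → t ℕ.≤ toℕ i → comp 𝐲 i ≤ᴵ comp 𝐳 i) → splice 𝐱 𝐲 𝐱≤𝐲 t ≤ᴸ 𝐳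
  splice-≤ 𝐳 below above i with toℕ i ℕ.<? t
  ... | yes i<t = below i i<t
  ... | no  i≮t = above i (ℕ.≮⇒≥ i≮t)

  ≤-splice : ∀ 𝐳 → (∀ i → toℕ i ℕ.< t → comp 𝐳 i ≤ᴵ comp 𝐱 i) →
    (∀ i → t ℕ.≤ toℕ i → comp 𝐳 i ≤ᴵ comp 𝐲 i) → 𝐳 ≤ᴸ splice 𝐱 𝐲 𝐱≤𝐲 t
  ≤-splice 𝐳 below above i with toℕ i ℕ.<? t
  ... | yes i<t = below i i<t
  ... | no  i≮t = above i (ℕ.≮⇒≥ i≮t)

  splice-below : ∀ {i} → toℕ i ℕ.< t → comp (splice 𝐱 𝐲 𝐱≤𝐲 t) i ≡ comp 𝐱 i
  splice-below {i} i<t with toℕ i ℕ.<? t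
  ... | yes _   = refl
  ... | no  i≮t = contradiction i<t i≮t

  splice-above : ∀ {i} → t ℕ.≤ toℕ i → comp (splice 𝐱 𝐲 𝐱≤𝐲 t) i ≡ comp 𝐲 i
  splice-above {i} t≤i with toℕ i ℕ.<? t
  ... | yes i<t = contradiction i<t (ℕ.≤⇒≯ t≤i)
  ... | no  _   = refl

descending⇒≤-first : ∀ {n} (v : Fin (suc n) → 𝕀) →
  (∀ k → v (Fin.suc k) ≤ᴵ v (inject₁ k)) → ∀ i → v i ≤ᴵ v Fin.zero
descending⇒≤-first v desc Fin.zero l = l
descending⇒≤-first {suc n} v desc (Fin.suc i) l =
  desc Fin.zero (descending⇒≤-first (λ j → v (Fin.suc j)) (λ k → desc (Fin.suc k)) i l)

-- Strong negations on diagonal points.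

module Strong {n} (𝒩 : L (suc n) → L (suc n)) (strong : IsStrongFuzzyNegation 𝒩) where
  open IsStrongFuzzyNegation strong

  ≤𝒩-swap : ∀ 𝐱 𝐲 → 𝐱 ≤ᴸ 𝒩 𝐲 → 𝐲 ≤ᴸ 𝒩 𝐱
  ≤𝒩-swap 𝐱 𝐲 𝐱≤𝒩𝐲 i l = antitone 𝐱 (𝒩 𝐲) 𝐱≤𝒩𝐲 i (proj₂ (involutive 𝐲 i) l)

  𝒩≤-swap : ∀ 𝐱 𝐲 → 𝒩 𝐱 ≤ᴸ 𝐲 → 𝒩 𝐲 ≤ᴸ 𝐱
  𝒩≤-swap 𝐱 𝐲 𝒩𝐱≤𝐲 i l = proj₁ (involutive 𝐱 i) (antitone (𝒩 𝐱) 𝐲 𝒩𝐱≤𝐲 i l)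

  𝒩-reflects : ∀ 𝐱 𝐲 → 𝒩 𝐱 ≤ᴸ 𝒩 𝐲 → 𝐲 ≤ᴸ 𝐱
  𝒩-reflects 𝐱 𝐲 𝒩𝐱≤𝒩𝐲 i l = proj₁ (involutive 𝐱 i) (≤𝒩-swap (𝒩 𝐱) 𝐲 𝒩𝐱≤𝒩𝐲 i l)

  last : Fin (suc n)
  last = fromℕ n

  first : Fin (suc n)
  first = Fin.zero

  last-≥ : ∀ 𝐱 i → comp 𝐱 i ≤ᴵ comp 𝐱 last
  last-≥ 𝐱 i = ascending 𝐱 i last (Fin.≤fromℕ i)

  -- `𝒩 / x / ≤ᴸ 𝐮` amounts to `𝒩 𝐮 ≤ᴸ / x /`, a condition on the last component of `𝒩 𝐮` alone, so
  -- meet-primality of `x` in `𝕀` transfers.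
  𝒩-diagonal-joinPrime : ∀ x 𝐮 𝐯 → (∀ 𝐰 → 𝐮 ≤ᴸ 𝐰 → 𝐯 ≤ᴸ 𝐰 → 𝒩 / x / ≤ᴸ 𝐰) →
    ¬ (𝒩 / x / ≤ᴸ 𝐮) → ¬ (𝒩 / x / ≤ᴸ 𝐯) → ⊥
  𝒩-diagonal-joinPrime x 𝐮 𝐯 lub ≰𝐮 ≰𝐯 =
    𝕀-meetPrime x (comp (𝒩 𝐮) last) (comp (𝒩 𝐯) last) glb
      (λ ≤x → ≰𝐮 (𝒩≤-swap 𝐮 / x / λ i l → ≤x (last-≥ (𝒩 𝐮) i l)))
      (λ ≤x → ≰𝐯 (𝒩≤-swap 𝐯 / x / λ i l → ≤x (last-≥ (𝒩 𝐯) i l)))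
    where
    glb : ∀ c → c ≤ᴵ comp (𝒩 𝐮) last → c ≤ᴵ comp (𝒩 𝐯) last → c ≤ᴵ x
    glb c c≤𝐮 c≤𝐯 {q} l = 𝐦≤x last (subst (λ a → Lower (value a) q)
        (sym (splice-above / 0ᴵ / / c / (λ _ → 0≤value c) n (ℕ.≤-reflexive (sym (Fin.toℕ-fromℕ n))))) l)
      where
      -- The tuple (0,...,0,c), least among those with last component at least `c`.
      𝐦 : L (suc n)
      𝐦 = splice / 0ᴵ / / c / (λ _ → 0≤value c) n

      𝐦≤ : ∀ 𝐳 → c ≤ᴵ comp 𝐳 last → 𝐦 ≤ᴸ 𝐳
      𝐦≤ 𝐳 c≤𝐳 = splice-≤ / 0ᴵ / / c / (λ _ → 0≤value c) n 𝐳
        (λ i _ → 0≤value (comp 𝐳 i))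
        (λ i n≤i l → ascending 𝐳 last i (subst (ℕ._≤ toℕ i) (sym (Fin.toℕ-fromℕ n)) n≤i) (c≤𝐳 l))

      𝐦≤x : 𝐦 ≤ᴸ / x /
      𝐦≤x = 𝒩-reflects / x / 𝐦 (lub (𝒩 𝐦)
        (≤𝒩-swap 𝐦 𝐮 (𝐦≤ (𝒩 𝐮) c≤𝐮)) (≤𝒩-swap 𝐦 𝐯 (𝐦≤ (𝒩 𝐯) c≤𝐯)))

  -- Dually, `𝐮 ≤ᴸ 𝒩 / x /` only constrains the first component of `𝒩 𝐮`. The test tuple is now
  -- (c,1,...,1), greatest among those with first component at most `c`.
  𝒩-diagonal-meetPrime : ∀ x 𝐮 𝐯 → (∀ 𝐰 → 𝐰 ≤ᴸ 𝐮 → 𝐰 ≤ᴸ 𝐯 → 𝐰 ≤ᴸ 𝒩 / x /) →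
    ¬ (𝐮 ≤ᴸ 𝒩 / x /) → ¬ (𝐯 ≤ᴸ 𝒩 / x /) → ⊥
  𝒩-diagonal-meetPrime x 𝐮 𝐯 glb 𝐮≰ 𝐯≰ =
    𝕀-joinPrime x (comp (𝒩 𝐮) first) (comp (𝒩 𝐯) first) lub
      (λ x≤ → 𝐮≰ (≤𝒩-swap / x / 𝐮 λ i l → ascending (𝒩 𝐮) first i z≤n (x≤ l)))
      (λ x≤ → 𝐯≰ (≤𝒩-swap / x / 𝐯 λ i l → ascending (𝒩 𝐯) first i z≤n (x≤ l)))
    where
    lub : ∀ c → comp (𝒩 𝐮) first ≤ᴵ c → comp (𝒩 𝐯) first ≤ᴵ c → x ≤ᴵ c
    lub c 𝐮≤c 𝐯≤c {q} l = subst (λ a → Lower (value a) q)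
        (splice-below / c / / 1ᴵ / (λ _ → value≤1 c) 1 {first} (s≤s z≤n)) (x≤𝐦 first l)
      where
      𝐦 : L (suc n)
      𝐦 = splice / c / / 1ᴵ / (λ _ → value≤1 c) 1

      ≤𝐦 : ∀ 𝐳 → comp 𝐳 first ≤ᴵ c → 𝐳 ≤ᴸ 𝐦
      ≤𝐦 𝐳 𝐳≤c = ≤-splice / c / / 1ᴵ / (λ _ → value≤1 c) 1 𝐳
        (λ i i<1 l → 𝐳≤c (ascending 𝐳 i first (ℕ.≤-pred i<1) l))
        (λ i _ → value≤1 (comp 𝐳 i))

      x≤𝐦 : / x / ≤ᴸ 𝐦
      x≤𝐦 = 𝒩-reflects 𝐦 / x / (glb (𝒩 𝐦)
        (𝒩≤-swap 𝐮 𝐦 (≤𝐦 (𝒩 𝐮) 𝐮≤c)) (𝒩≤-swap 𝐯 𝐦 (≤𝐦 (𝒩 𝐯) 𝐯≤c)))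

  -- Excluding gaps in the image of the diagonal.

  Gap : 𝕀 → Fin n → Set
  Gap x k = comp (𝒩 / x /) (inject₁ k) <ᴵ comp (𝒩 / x /) (Fin.suc k)

  -- `𝒩 / x /` lies below the join of the constant tuple at the lower side of the gap and of itself
  -- with the components up to `k` set to 0. The gap rules out the first joinand, and a positive
  -- component up to `k` would rule out the second.
  gap-below : ∀ x k → Gap x k → ∀ i → toℕ i ℕ.< suc (toℕ k) → comp (𝒩 / x /) i ≤ᴵ 0ᴵ
  gap-below x k gap i i<1+k = ≮⇒≥ᴿ 0ᴿ (value (comp 𝐲 i)) λ 0<yᵢ →
    𝒩-diagonal-joinPrime x / comp 𝐲 (inject₁ k) / 𝐯 lub
      (λ 𝐲≤ → <⇒≱ᴿ (value (comp 𝐲 (inject₁ k))) (value (comp 𝐲 (Fin.suc k))) gap (𝐲≤ (Fin.suc k)))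
      (λ 𝐲≤𝐯 → <⇒≱ᴿ 0ᴿ (value (comp 𝐲 i)) 0<yᵢ λ {q} l →
        subst (λ a → Lower (value a) q) (splice-below / 0ᴵ / 𝐲 0≤𝐲 (suc (toℕ k)) i<1+k) (𝐲≤𝐯 i l))
    where
    𝐲 : L (suc n)
    𝐲 = 𝒩 / x /

    0≤𝐲 : / 0ᴵ / ≤ᴸ 𝐲
    0≤𝐲 j = 0≤value (comp 𝐲 j)

    𝐯 : L (suc n)
    𝐯 = splice / 0ᴵ / 𝐲 0≤𝐲 (suc (toℕ k))

    lub : ∀ 𝐰 → / comp 𝐲 (inject₁ k) / ≤ᴸ 𝐰 → 𝐯 ≤ᴸ 𝐰 → 𝐲 ≤ᴸ 𝐰
    lub 𝐰 𝐮≤𝐰 𝐯≤𝐰 j {q} l with toℕ j ℕ.<? suc (toℕ k)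
    ... | yes j<1+k = 𝐮≤𝐰 j (ascending 𝐲 j (inject₁ k)
      (subst (toℕ j ℕ.≤_) (sym (Fin.toℕ-inject₁ k)) (ℕ.≤-pred j<1+k)) l)
    ... | no j≮1+k = 𝐯≤𝐰 j (subst (λ a → Lower (value a) q)
      (sym (splice-above / 0ᴵ / 𝐲 0≤𝐲 (suc (toℕ k)) (ℕ.≮⇒≥ j≮1+k))) l)

  -- Dual: the meet of the constant tuple at the upper side of the gap and of `𝒩 / x /` with the
  -- components past `k` set to 1.
  gap-above : ∀ x k → Gap x k → ∀ i → suc (toℕ k) ℕ.≤ toℕ i → 1ᴵ ≤ᴵ comp (𝒩 / x /) i
  gap-above x k gap i k<i = ≮⇒≥ᴿ (value (comp 𝐲 i)) 1ᴿ λ yᵢ<1 →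
    𝒩-diagonal-meetPrime x / comp 𝐲 (Fin.suc k) / 𝐯 glb
      (λ ≤𝐲 → <⇒≱ᴿ (value (comp 𝐲 (inject₁ k))) (value (comp 𝐲 (Fin.suc k))) gap (≤𝐲 (inject₁ k)))
      (λ 𝐯≤𝐲 → <⇒≱ᴿ (value (comp 𝐲 i)) 1ᴿ yᵢ<1 λ {q} l →
        𝐯≤𝐲 i (subst (λ a → Lower (value a) q)
          (sym (splice-above 𝐲 / 1ᴵ / 𝐲≤1 (suc (toℕ k)) k<i)) l))
    where
    𝐲 : L (suc n)
    𝐲 = 𝒩 / x /

    𝐲≤1 : 𝐲 ≤ᴸ / 1ᴵ /
    𝐲≤1 j = value≤1 (comp 𝐲 j)

    𝐯 : L (suc n)
    𝐯 = splice 𝐲 / 1ᴵ / 𝐲≤1 (suc (toℕ k))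

    glb : ∀ 𝐰 → 𝐰 ≤ᴸ / comp 𝐲 (Fin.suc k) / → 𝐰 ≤ᴸ 𝐯 → 𝐰 ≤ᴸ 𝐲
    glb 𝐰 𝐰≤𝐮 𝐰≤𝐯 j {q} l with toℕ j ℕ.<? suc (toℕ k)
    ... | yes j<1+k = subst (λ a → Lower (value a) q)
      (splice-below 𝐲 / 1ᴵ / 𝐲≤1 (suc (toℕ k)) j<1+k) (𝐰≤𝐯 j l)
    ... | no j≮1+k = ascending 𝐲 (Fin.suc k) j (ℕ.≮⇒≥ j≮1+k) (𝐰≤𝐮 j l)

  no-gap : ∀ x k → ¬ Gap x k
  no-gap x k gap = <⇒≱ᴿ (value (comp 𝐲 (inject₁ k))) (value (comp 𝐲 (Fin.suc k))) gap λ {q} l →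
    𝐳≤𝐲 (inject₁ k) (subst (λ a → Lower (value a) q)
      (sym (splice-above / 0ᴵ / / 1ᴵ / 0≤1 (toℕ k) k≤k)) (value≤1 (comp 𝐲 (Fin.suc k)) l))
    where
    𝐲 : L (suc n)
    𝐲 = 𝒩 / x /

    0≤1 : / 0ᴵ / ≤ᴸ / 1ᴵ /
    0≤1 _ = value≤1 0ᴵ

    k≤k : toℕ k ℕ.≤ toℕ (inject₁ k)
    k≤k = ℕ.≤-reflexive (sym (Fin.toℕ-inject₁ k))

    -- Its ones start at index `k`, one place earlier than those of `𝐲`; hence `𝐳 ≤ᴸ 𝐲` would
    -- contradict the gap.
    𝐳 : L (suc n)
    𝐳 = splice / 0ᴵ / / 1ᴵ / 0≤1 (toℕ k)

    𝐲≤ : ∀ x′ → x′ <ᴵ x → 𝐲 ≤ᴸ 𝒩 / x′ /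
    𝐲≤ x′ x′<x = antitone / x′ / / x / λ _ → <⇒≤ᴿ (value x′) (value x) x′<x

    gap-closes : ∀ x′ → x′ <ᴵ x → 1ᴵ ≤ᴵ comp (𝒩 / x′ /) (inject₁ k)
    -- Otherwise `𝒩 / x′ /` has a gap at `k` too, so both images are the same tuple of zeros and
    -- ones, and reflecting the order gives `x ≤ᴵ x′`.
    gap-closes x′ x′<x = ≮⇒≥ᴿ (value (comp (𝒩 / x′ /) (inject₁ k))) 1ᴿ λ { (q , u , q<1) →
      let gap′ : Gap x′ k
          gap′ = q , u , 𝐲≤ x′ x′<x (Fin.suc k) (gap-above x k gap (Fin.suc k) ℕ.≤-refl q<1)
      in <⇒≱ᴿ (value x′) (value x) x′<x (𝒩-reflects / x′ / / x / (collapse x′ gap′) first) }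
      where
      collapse : ∀ x′ → Gap x′ k → 𝒩 / x′ / ≤ᴸ 𝐲
      collapse x′ gap′ i l with toℕ i ℕ.<? suc (toℕ k)
      ... | yes i<1+k = 0≤value (comp 𝐲 i) (gap-below x′ k gap′ i i<1+k l)
      ... | no  i≮1+k = gap-above x k gap i (ℕ.≮⇒≥ i≮1+k) (value≤1 (comp (𝒩 / x′ /) i) l)

    𝐳≤ : ∀ x′ → x′ <ᴵ x → 𝐳 ≤ᴸ 𝒩 / x′ /
    𝐳≤ x′ x′<x = splice-≤ / 0ᴵ / / 1ᴵ / 0≤1 (toℕ k) (𝒩 / x′ /)
      (λ i _ → 0≤value (comp (𝒩 / x′ /) i))
      (λ i k≤i l → ascending (𝒩 / x′ /) (inject₁ k) i
        (subst (ℕ._≤ toℕ i) (sym (Fin.toℕ-inject₁ k)) k≤i) (gap-closes x′ x′<x l))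

    𝐳≤𝐲 : 𝐳 ≤ᴸ 𝐲
    -- `𝒩 𝐳` is above every `/ x′ /` with `x′ <ᴵ x`, hence above `/ x /`: a rational strictly
    -- between a component and `x` refutes the contrary.
    𝐳≤𝐲 = ≤𝒩-swap / x / 𝐳 λ i → ≮⇒≥ᴿ (value (comp (𝒩 𝐳) i)) (value x) λ 𝒩𝐳ᵢ<x →
      let x′ = between (comp (𝒩 𝐳) i) x 𝒩𝐳ᵢ<x
      in <⇒≱ᴿ (value (comp (𝒩 𝐳) i)) (value x′) (<-between (comp (𝒩 𝐳) i) x 𝒩𝐳ᵢ<x)
           (≤𝒩-swap 𝐳 / x′ / (𝐳≤ x′ (between-< (comp (𝒩 𝐳) i) x 𝒩𝐳ᵢ<x)) i)

  -- The induced strong negation on the unit interval.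

  diagonal : 𝕀 → 𝕀
  diagonal x = comp (𝒩 / x /) first

  𝒩-diagonal : ∀ x → 𝒩 / x / ≈ᴸ / diagonal x /
  𝒩-diagonal x i =
    descending⇒≤-first (comp (𝒩 / x /))
      (λ k → ≮⇒≥ᴿ (value (comp (𝒩 / x /) (inject₁ k))) (value (comp (𝒩 / x /) (Fin.suc k)))
        (no-gap x k)) i ,
    ascending (𝒩 / x /) first i z≤n

  diagonal-antitone : ∀ x y → x ≤ᴵ y → diagonal y ≤ᴵ diagonal x
  diagonal-antitone x y x≤y = antitone / x / / y / (λ _ → x≤y) first

  diagonal-involutive : ∀ x → diagonal (diagonal x) ≈ᴵ x
  diagonal-involutive x =
    (λ l → proj₁ (involutive / x / first) (proj₂ (𝒩𝒩≈ first) l)) ,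
    (λ l → proj₁ (𝒩𝒩≈ first) (proj₂ (involutive / x / first) l))
    where
    𝒩𝒩≈ : 𝒩 (𝒩 / x /) ≈ᴸ 𝒩 / diagonal x /
    𝒩𝒩≈ = cong (𝒩 / x /) / diagonal x / (𝒩-diagonal x)

-- The crossing point of an antitone map with the identity.

module AntitoneCut (g : ℚ → ℝ) (antitone : ∀ {p q} → p ℚ.≤ q → g q ≤ᴿ g p) where

  upper-antitone : ∀ {p q r} → p ℚ.≤ q → Upper (g p) r → Upper (g q) r
  upper-antitone {p} {q} p≤q = ≤ᴿ⇒upper {g q} {g p} (antitone p≤q)

  -- As `g` may jump, `r < g r` need not persist for slightly larger `r`; asking for such an `r`
  -- strictly beyond `q` makes each half rounded.
  cut : (∃[ r ] Lower (g r) r) → (∃[ r ] Upper (g r) r) → ℝ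
  cut (a , a<ga) (b , gb<b) = record
    { Lower           = λ q → ∃[ r ] (q ℚ.< r × Lower (g r) r)
    ; Upper           = λ q → ∃[ r ] (r ℚ.< q × Upper (g r) r)
    ; lower-inhabited = proj₁ (lower-inhabited (fromℚ a)) , a , proj₂ (lower-inhabited (fromℚ a)) , a<ga
    ; upper-inhabited = proj₁ (upper-inhabited (fromℚ b)) , b , proj₂ (upper-inhabited (fromℚ b)) , gb<b
    ; lower-rounded   = λ q → mk⇔
        (λ (r , q<r , r<gr) → let (m , q<m , m<r) = ℚ.<-dense q<r in m , q<m , r , m<r , r<gr)
        (λ (m , q<m , r , m<r , r<gr) → r , ℚ.<-trans q<m m<r , r<gr)
    ; upper-rounded   = λ q → mk⇔
        (λ (r , r<q , gr<r) → let (m , r<m , m<q) = ℚ.<-dense r<q in m , m<q , r , r<m , gr<r)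
        (λ (m , m<q , r , r<m , gr<r) → r , ℚ.<-trans r<m m<q , gr<r)
    ; disjoint        = λ q ((r , q<r , r<gr) , (s , s<q , gs<s)) →
        let s<r = ℚ.<-trans s<q q<r
        in disjoint (g r) s (lower-< (g r) s<r r<gr , upper-antitone (ℚ.<⇒≤ s<r) gs<s)
    ; located         = loc
    }
    where
    loc : ∀ {p q} → p ℚ.< q → _
    -- Two intermediate points: `s` and `t` are compared through `g s`, and `p < s`, `t < q` supply
    -- the strictness both halves demand.
    loc p<q with ℚ.<-dense p<q
    ... | s , p<s , s<q with ℚ.<-dense s<q
    ...   | t , s<t , t<q with located (g s) s<t
    ...     | inj₁ s<gs = inj₁ (s , p<s , s<gs)
    ...     | inj₂ gs<t = inj₂ (t , t<q , upper-antitone (ℚ.<⇒≤ s<t) gs<t)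

-- Fixed point of a strong negation on the unit interval.

clamp : ℚ → 𝕀
clamp q = fromℚᴵ (0ℚ ⊔ (q ⊓ 1ℚ)) (ℚ.p≤p⊔q 0ℚ (q ⊓ 1ℚ))
  (ℚ.⊔-lub (ℚ.<⇒≤ (ℚ.positive⁻¹ 1ℚ)) (ℚ.p⊓q≤q q 1ℚ))

clamp-mono : ∀ {p q} → p ℚ.≤ q → clamp p ≤ᴵ clamp q
clamp-mono {p} {q} p≤q l = ℚ.<-≤-trans l (ℚ.⊔-monoʳ-≤ 0ℚ (ℚ.⊓-monoˡ-≤ 1ℚ p≤q))

≤-clamp : ∀ {q} → q ℚ.≤ 1ℚ → fromℚ q ≤ᴿ value (clamp q)
≤-clamp {q} q≤1 l = ℚ.<-≤-trans l
  (ℚ.≤-trans (ℚ.⊓-glb ℚ.≤-refl q≤1) (ℚ.p≤q⊔p 0ℚ (q ⊓ 1ℚ)))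

clamp-≤ : ∀ {q} → 0ℚ ℚ.≤ q → value (clamp q) ≤ᴿ fromℚ q
clamp-≤ {q} 0≤q l = ℚ.<-≤-trans l (ℚ.⊔-lub 0≤q (ℚ.p⊓q≤p q 1ℚ))

module UnitFixedPoint (f : 𝕀 → 𝕀) (f-antitone : ∀ x y → x ≤ᴵ y → f y ≤ᴵ f x)
  (f-involutive : ∀ x → f (f x) ≈ᴵ x) where

  g : ℚ → ℝ
  g q = value (f (clamp q))

  g-antitone : ∀ {p q} → p ℚ.≤ q → g q ≤ᴿ g p
  g-antitone {p} {q} p≤q = f-antitone (clamp p) (clamp q) (clamp-mono p≤q)

  open AntitoneCut g g-antitone

  e : 𝕀
  e = mk𝕀 (cut (a , 0≤value (f (clamp a)) a<0) (b , ≤ᴿ⇒upper {g b} {1ᴿ} (value≤1 (f (clamp b))) 1<b))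
    (λ q<0 → let (r , q<r , r<0) = ℚ.<-dense q<0 in r , q<r , 0≤value (f (clamp r)) r<0)
    (λ (r , q<r , r<gr) → ℚ.<-trans q<r (value≤1 (f (clamp r)) r<gr))
    where
    a b : ℚ
    a = proj₁ (lower-inhabited 0ᴿ)
    b = proj₁ (upper-inhabited 1ᴿ)

    a<0 : a ℚ.< 0ℚ
    a<0 = proj₂ (lower-inhabited 0ᴿ)

    1<b : 1ℚ ℚ.< b
    1<b = proj₂ (upper-inhabited 1ᴿ)

  e≤g : ∀ {s} → Lower (value e) s → value e ≤ᴿ g s
  e≤g {s} (r , s<r , r<gr) (r′ , q<r′ , r′<gr′) with ℚ.≤-total r′ s
  ... | inj₁ r′≤s = g-antitone (ℚ.<⇒≤ s<r)
    (lower-< (g r) (ℚ.<-trans (ℚ.<-≤-trans q<r′ r′≤s) s<r) r<gr)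
  ... | inj₂ s≤r′ = g-antitone s≤r′ (lower-< (g r′) q<r′ r′<gr′)

  g≤e : ∀ {s} → Upper (value e) s → g s ≤ᴿ value e
  g≤e {s} (r , r<s , gr<r) = ≮⇒≥ᴿ (value e) (g s) above
    where
    above : ¬ (value e <ᴿ g s)
    above (q , (r′ , r′<q , gr′<r′) , q<gs) with ℚ.≤-total r′ s
    ... | inj₁ r′≤s = disjoint (g s) q (q<gs , upper-< (g s) r′<q (upper-antitone r′≤s gr′<r′))
    ... | inj₂ s≤r′ = disjoint (g s) q (q<gs ,
      upper-< (g s) (ℚ.<-trans (ℚ.<-≤-trans r<s s≤r′) r′<q) (upper-antitone (ℚ.<⇒≤ r<s) gr<r))

  -- If `f e < s < e`, then `e ≤ f s` by `e≤g`, so `s = f (f s) ≤ f e`: involutivity replaces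
  -- continuity.
  e≤fe : e ≤ᴵ f e
  e≤fe = ≮⇒≥ᴿ (value (f e)) (value e) λ (s , fe<s , s<e) →
    -- `s` is not in its own lower half, so a slightly smaller `s₀` carries the contradiction.
    let (s₀ , s₀<s , fe<s₀) = Equivalence.to (upper-rounded (value (f e)) s) fe<s
        s₀<clamp = ≤-clamp (ℚ.<⇒≤ (value≤1 e s<e)) s₀<s
        s₀<ffclamp = proj₂ (f-involutive (clamp s)) s₀<clamp
    in disjoint (value (f e)) s₀ (f-antitone e (f (clamp s)) (e≤g s<e) s₀<ffclamp , fe<s₀)

  fe≤e : f e ≤ᴵ e
  fe≤e = ≮⇒≥ᴿ (value e) (value (f e)) λ (s , e<s , s<fe) →
    let s<clamp = proj₁ (f-involutive (clamp s)) (f-antitone (f (clamp s)) e (g≤e e<s) s<fe)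
        0≤s = ℚ.<⇒≤ (≤ᴿ⇒upper {0ᴿ} {value e} (0≤value e) e<s)
    in ℚ.<-irrefl refl (clamp-≤ 0≤s s<clamp)

corollary27 : ∀ (n : ℕ) → n ≥ 1 → (𝒩 : L n → L n) → IsStrongFuzzyNegation 𝒩 →
    ∃[ 𝐞 ] (𝐞 ∈ 𝒟 n × IsEquilibriumPoint 𝒩 𝐞)
corollary27 (suc n) _ 𝒩 strong = / e / , (e , λ _ → (λ l → l) , (λ l → l)) , λ i →
  (λ l → fe≤e (proj₁ (𝒩-diagonal e i) l)) ,
  (λ l → proj₂ (𝒩-diagonal e i) (e≤fe l))
  where
  open Strong 𝒩 strong
  open UnitFixedPoint diagonal diagonal-antitone diagonal-involutive
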